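{- For every finite simple graph $G$, $\chi_2(G)-\chi(G)\le \frac{\alpha(G)+\omega(G)}{2}+3$.
   Context: $\chi(G)$ is the chromatic number, $\alpha(G)$ the independence number and $\omega(G)$ the clique number of $G$. A dynamic coloring of $G$ is a proper vertex coloring such that for every vertex $v$ of degree at least $2$, the neighbours of $v$ receive at least two different colors; $\chi_2(G)$ is the smallest number of colors in a dynamic coloring of $G$. -}

module Defs where

open import Data.Nat using (ℕ; _≤_; _+_)
open import Data.Bool using (Bool; true; false; if_then_else_)
open import Data.Fin using (Fin)
open import Data.Fin.Subset using (Subset; _∈_; ∣_∣)
open import Data.List using (List; map; allFin)
open import Data.Nat.ListAction using (sum)
open import Data.Product using (Σ; _×_; ∃; ∃-syntax)
open import Relation.Binary.PropositionalEquality using (_≡_; _≢_)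

record Graph (n : ℕ) : Set where
  field
    adj   : Fin n → Fin n → Bool
    sym   : ∀ u v → adj u v ≡ adj v u
    irrefl : ∀ v → adj v v ≡ false
open Graph public

module _ {n : ℕ} (G : Graph n) where

  degree : Fin n → ℕ
  degree v = sum (map (λ u → if adj G v u then 1 else 0) (allFin n))

  Proper : (k : ℕ) → (Fin n → Fin k) → Set
  Proper k c = ∀ u v → adj G u v ≡ true → c u ≢ c v

  Dynamic : (k : ℕ) → (Fin n → Fin k) → Set
  Dynamic k c = Proper k c ×
    (∀ v → 2 ≤ degree v →
       ∃[ u ] ∃[ w ] (adj G v u ≡ true × adj G v w ≡ true × c u ≢ c w))

  Colourable : ℕ → Set
  Colourable k = Σ (Fin n → Fin k) (Proper k)

  DynColourable : ℕ → Set
  DynColourable k = Σ (Fin n → Fin k) (Dynamic k)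

  Independent : Subset n → Set
  Independent S = ∀ u v → u ∈ S → v ∈ S → adj G u v ≡ false

  Clique : Subset n → Set
  Clique S = ∀ u v → u ∈ S → v ∈ S → u ≢ v → adj G u v ≡ true

  IsChromaticNumber : ℕ → Set
  IsChromaticNumber k = Colourable k × (∀ m → Colourable m → k ≤ m)

  IsDynamicChromaticNumber : ℕ → Set
  IsDynamicChromaticNumber k = DynColourable k × (∀ m → DynColourable m → k ≤ m)

  IsIndependenceNumber : ℕ → Set
  IsIndependenceNumber a =
    (∃[ S ] (Independent S × ∣ S ∣ ≡ a)) × (∀ S → Independent S → ∣ S ∣ ≤ a)

  IsCliqueNumber : ℕ → Set
  IsCliqueNumber w =
    (∃[ S ] (Clique S × ∣ S ∣ ≡ w)) × (∀ S → Clique S → ∣ S ∣ ≤ w)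

{-# OPTIONS --safe #-}
-- Let S be a maximum independent set, X the vertices outside S with all their
-- neighbours in S, and split the vertices of S into M (with a neighbour in X) and
-- Z (without); vertices with at most one neighbour are ignored.  Start from an
-- optimal proper colouring.  S receives new colours such that each vertex of X sees
-- two of them; X is recoloured with the old colours and some new ones such that
-- each vertex of M sees two colours; a minimal set T of vertices meeting the
-- neighbourhood of each vertex of Z receives k new colours, members without conflict being
-- paired up to share a colour.  A vertex outside S ∪ X needs no care: it has
-- neighbours in S and outside S, and their palettes are disjoint.
-- For the first two recolourings, every pair of colours at least one of which is new
-- yields its own vertex of X, respectively M.  For the third, 2 k ≤ z + ω for some
-- z witnesses in Z.  As X ∪ Z and M ∪ Z are independent, the bound follows.
module Submission where

open import Defs
open import Data.Bool using (true; false; if_then_else_)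
import Data.Bool.Properties as Bool
open import Data.Fin using (Fin; toℕ; fromℕ<)
open import Data.Fin.Properties using (_≟_; any?; all?; toℕ-injective; toℕ<n; fromℕ<-injective)
open import Data.Fin.Subset using (Subset; ∣_∣; _∪_; ⁅_⁆)
import Data.Fin.Subset as Subset
open import Data.Fin.Subset.Properties
  using (x∈p∧x≢y⇒x∈p-y; x∈p⇒∣p-x∣<∣p∣; p⊂q⇒∣p∣<∣q∣; p⊆p∪q; x∈p∪q⁺; x∈p∪q⁻; x∈⁅x⁆; x∈⁅y⁆⇒x≡y)
  renaming (_∈?_ to _∈S?_)
open import Data.List using (List; []; _∷_; _++_; length; map; tabulate; allFin)
open import Data.List.Membership.Propositional using (_∈_)
open import Data.List.Membership.Propositional.Properties using (∈-++⁻; ∈-tabulate⁻; ∈-allFin)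
import Data.List.Membership.DecPropositional as DecMembership
open import Data.List.Properties using (length-++; length-tabulate)
open import Data.List.Relation.Unary.All using ([]; _∷_)
import Data.List.Relation.Unary.All as All
open import Data.List.Relation.Unary.Any using (here; there)
open import Data.List.Relation.Unary.Unique.Propositional using (Unique; []; _∷_)
import Data.List.Relation.Unary.Unique.Propositional.Properties as Unique
open import Data.Maybe using (Maybe; just; nothing)
import Data.Maybe.Properties as Maybe
open import Data.Nat using (ℕ; zero; suc; _≤_; _<_; _+_; _*_; z≤n; s≤s; s≤s⁻¹)
open import Data.Nat.ListAction using (sum)
import Data.Nat.Properties as ℕ
open import Data.Nat.Solver using (module +-*-Solver)
open import Data.Product using (∃-syntax; _×_; _,_; proj₁; proj₂)
open import Data.Sum using (_⊎_; inj₁; inj₂; swap)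
import Data.Vec as Vec
import Data.Vec.Properties as Vec
open import Data.Vec.Functional using (updateAt)
open import Data.Vec.Functional.Properties using (updateAt-updates; updateAt-minimal)
open import Function using (_∘_; const)
open import Relation.Binary.PropositionalEquality
  using (_≡_; _≢_; refl; trans; cong; cong₂; subst; module ≡-Reasoning) renaming (sym to ≡-sym)
open import Relation.Nullary using (¬_; Dec; yes; no; does; contradiction; ¬?; _×-dec_; _⊎-dec_; _→-dec_)
open import Relation.Nullary.Decidable using (dec-true; toWitness)
open import Relation.Unary using (Decidable)

open +-*-Solver using (solve; con; _:+_; _:*_; _:=_)
open module FinMembership {n} = DecMembership (_≟_ {n}) using (_∈?_)

-- Adjacency and vertices with two distinct neighbours.

module Adjacency {n : ℕ} (G : Graph n) where

  infix 4 _~_ _~?_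

  _~_ : Fin n → Fin n → Set
  u ~ v = adj G u v ≡ true

  _~?_ : ∀ u v → Dec (u ~ v)
  u ~? v = adj G u v Bool.≟ true

  ~-sym : ∀ {u v} → u ~ v → v ~ u
  ~-sym {u} {v} u~v = trans (sym G v u) u~v

  ~-irrefl : ∀ {u} → ¬ u ~ u
  ~-irrefl {u} u~u with trans (≡-sym u~u) (irrefl G u)
  ... | ()

  -- The form in which degree at least 2 enters the proof; `2≤degree⇒branching` links it to the sum
  -- in `degree`.
  Branching : Fin n → Set
  Branching v = ∃[ u ] ∃[ w ] (v ~ u × v ~ w × u ≢ w)

  branching? : Decidable Branching
  branching? v = any? λ u → any? λ w → (v ~? u) ×-dec (v ~? w) ×-dec ¬? (u ≟ w)

  another : ∀ {v} → Branching v → ∀ u → ∃[ w ] (v ~ w × w ≢ u)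
  another (x , y , v~x , v~y , x≢y) u with x ≟ u
  ... | yes refl = y , v~y , x≢y ∘ ≡-sym
  ... | no  x≢u  = x , v~x , x≢u

-- First-fit recolouring with a count of witnesses.

-- The number of pairs among q old and g new colours that contain a new one.
tri : ℕ → ℕ → ℕ
tri q zero    = 0
tri q (suc g) = tri q g + (q + g)

-- First-fit colouring.  A vertex that admits none of the q + g colours in use
-- supplies, for each of these colours, a member of E all of whose other
-- neighbours carry that colour; these q + g members are distinct, and new
-- because the vertex had been uncoloured.
module FirstFit {n : ℕ} (G : Graph n) {E U : Fin n → Set}
  (E? : Decidable E) (U? : Decidable U) (base : Fin n → ℕ) (q : ℕ)
  (base< : ∀ v → base v < q)
  (E-branching : ∀ {e} → E e → Adjacency.Branching G e)
  (E-meets-U : ∀ {e} → E e → ∃[ u ] (U u × adj G e u ≡ true)) where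

  open Adjacency G

  Partial : Set
  Partial = Fin n → Maybe ℕ

  _[_≔_] : Partial → Fin n → ℕ → Partial
  a [ u ≔ i ] = updateAt a u (const (just i))

  -- An uncoloured neighbour rules this out. Hence `valid` holds at the start, where each member of
  -- `E` has a neighbour in the still uncoloured `U`.
  Mono : Partial → Fin n → ℕ → Set
  Mono a e i = ∀ w → e ~ w → a w ≡ just i

  mono? : ∀ a e i → Dec (Mono a e i)
  mono? a e i = all? λ w → (e ~? w) →-dec Maybe.≡-dec ℕ._≟_ (a w) (just i)

  Coloured : Partial → Fin n → Set
  Coloured a v = ∃[ i ] a v ≡ just i

  record State (g : ℕ) (a : Partial) : Set where
    field
      bounded   : ∀ {v i} → a v ≡ just i → i < q + g
      off       : ∀ {v} → ¬ U v → a v ≡ just (base v)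
      valid     : ∀ {e} → E e → ∀ i → ¬ Mono a e i
      witnesses : List (Fin n)
      unique    : Unique witnesses
      ⊆E        : ∀ {e} → e ∈ witnesses → E e
      -- Any later witness has a neighbour that is uncoloured up to then, so this field keeps it
      -- apart from the earlier ones.
      coloured  : ∀ {e} → e ∈ witnesses → ∀ {w} → e ~ w → Coloured a w
      size      : length witnesses ≡ tri q g

  Blocked : Partial → Fin n → ℕ → Set
  Blocked a u i = ∃[ e ] (E e × Mono (a [ u ≔ i ]) e i)

  blocked? : ∀ a u i → Dec (Blocked a u i)
  blocked? a u i = any? λ e → E? e ×-dec mono? (a [ u ≔ i ]) e i

  coloured-mono : ∀ {a u} i → ∀ {v} → Coloured a v → Coloured (a [ u ≔ i ]) v
  coloured-mono {a} {u} i {v} (j , av≡j) with v ≟ u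
  ... | yes refl = i , updateAt-updates v a
  ... | no  v≢u  = j , trans (updateAt-minimal v u a v≢u) av≡j

  module _ {g a} (st : State g a) {u} (au≡∅ : a u ≡ nothing) where
    open State st

    -- The second neighbour comes from `E-branching`, and its colour is not affected by the update
    -- at `u`. It ties a blocking vertex to one colour, which gives `w-injective`, and shows that
    -- this colour is in use, which gives `fresh-free`.
    other-neighbour : ∀ {e i} → E e → Mono (a [ u ≔ i ]) e i → ∃[ w ] (e ~ w × w ≢ u × a w ≡ just i)
    other-neighbour Ee mono with another (E-branching Ee) u
    ... | w , e~w , w≢u = w , e~w , w≢u ,
      trans (≡-sym (updateAt-minimal w u a w≢u)) (mono w e~w)

    mono-misses : ∀ {e i j} → ¬ e ~ u → Mono (a [ u ≔ i ]) e j → Mono a e j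
    mono-misses {e} e≁u mono w e~w =
      trans (≡-sym (updateAt-minimal w u a λ { refl → e≁u e~w })) (mono w e~w)

    blocked-adj : ∀ {e i} → E e → Mono (a [ u ≔ i ]) e i → e ~ u
    blocked-adj {e} {i} Ee mono with e ~? u
    ... | yes e~u = e~u
    ... | no  e≁u = contradiction (mono-misses e≁u mono) (valid Ee i)

    -- Common to both cases of `step`: `ws` is empty if some colour in use is free for `u`, and
    -- lists the blocking vertices if a new colour has to be opened.
    extend : ∀ {g′ i} → g ≤ g′ → i < q + g′ → ¬ Blocked a u i →
             (ws : List (Fin n)) → Unique (ws ++ witnesses) →
             (∀ {e} → e ∈ ws → E e) →
             (∀ {e} → e ∈ ws → ∀ {w} → e ~ w → Coloured (a [ u ≔ i ]) w) →
             length (ws ++ witnesses) ≡ tri q g′ → State g′ (a [ u ≔ i ])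
    extend {g′} {i} g≤g′ i< free ws uniq ws⊆E ws-coloured sz = record
      { bounded   = bounded′
      ; off       = λ {v} ¬Uv → trans (updateAt-minimal v u a (v≢u ¬Uv)) (off ¬Uv)
      ; valid     = valid′
      ; witnesses = ws ++ witnesses
      ; unique    = uniq
      ; ⊆E        = λ e∈ → case-⊆E (∈-++⁻ ws e∈)
      ; coloured  = λ e∈ → case-coloured (∈-++⁻ ws e∈)
      ; size      = sz
      }
      where
      v≢u : ∀ {v} → ¬ U v → v ≢ u
      v≢u ¬Uv refl with trans (≡-sym au≡∅) (off ¬Uv)
      ... | ()

      bounded′ : ∀ {v j} → (a [ u ≔ i ]) v ≡ just j → j < q + g′
      bounded′ {v} eq with v ≟ u
      ... | yes refl = subst (_< q + g′) (Maybe.just-injective (trans (≡-sym (updateAt-updates v a)) eq)) i<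
      ... | no  v≢u  = ℕ.<-≤-trans (bounded (trans (≡-sym (updateAt-minimal v u a v≢u)) eq)) (ℕ.+-monoʳ-≤ q g≤g′)

      valid′ : ∀ {e} → E e → ∀ j → ¬ Mono (a [ u ≔ i ]) e j
      valid′ {e} Ee j mono with e ~? u
      ... | no  e≁u = valid Ee j (mono-misses e≁u mono)
      ... | yes e~u with Maybe.just-injective (trans (≡-sym (updateAt-updates u a)) (mono u e~u))
      ...   | refl = free (e , Ee , mono)

      case-⊆E : ∀ {e} → e ∈ ws ⊎ e ∈ witnesses → E e
      case-⊆E (inj₁ e∈) = ws⊆E e∈
      case-⊆E (inj₂ e∈) = ⊆E e∈

      case-coloured : ∀ {e} → e ∈ ws ⊎ e ∈ witnesses → ∀ {w} → e ~ w → Coloured (a [ u ≔ i ]) w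
      case-coloured (inj₁ e∈) e~w = ws-coloured e∈ e~w
      case-coloured (inj₂ e∈) e~w = coloured-mono {a} {u} i (coloured e∈ e~w)

    fresh-free : ¬ Blocked a u (q + g)
    fresh-free (e , Ee , mono) with other-neighbour Ee mono
    ... | _ , _ , _ , aw≡ = ℕ.<-irrefl refl (bounded aw≡)

    step : ∃[ g′ ] ∃[ i ] State g′ (a [ u ≔ i ])
    step with any? (λ (k : Fin (q + g)) → ¬? (blocked? a u (toℕ k)))
    ... | yes (k , free) = g , toℕ k ,
      extend ℕ.≤-refl (toℕ<n k) free [] unique (λ ()) (λ ()) size
    ... | no all-blocked = suc g , q + g ,
      extend (ℕ.n≤1+n g) (ℕ.+-monoʳ-< q (ℕ.n<1+n g)) fresh-free (tabulate w)
        (Unique.++⁺ (Unique.tabulate⁺ w-injective) unique λ (e∈new , e∈old) → disjoint e∈new e∈old)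
        (λ e∈ → new-E (∈-tabulate⁻ e∈))
        (λ e∈ {x} e~x → new-coloured (∈-tabulate⁻ e∈) x e~x)
        (trans (length-++ (tabulate w)) (trans (cong₂ _+_ (length-tabulate w) size) (ℕ.+-comm (q + g) (tri q g))))
      where
      blocked : ∀ k → Blocked a u (toℕ k)
      blocked k with blocked? a u (toℕ k)
      ... | yes b = b
      ... | no ¬b = contradiction (k , ¬b) all-blocked

      w : Fin (q + g) → Fin n
      w k = proj₁ (blocked k)

      w-E : ∀ k → E (w k)
      w-E k = proj₁ (proj₂ (blocked k))

      w-mono : ∀ k → Mono (a [ u ≔ toℕ k ]) (w k) (toℕ k)
      w-mono k = proj₂ (proj₂ (blocked k))

      w-injective : ∀ {k l} → w k ≡ w l → k ≡ l
      w-injective {k} {l} eq with other-neighbour (w-E k) (w-mono k)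
      ... | x , e~x , x≢u , ax≡k = toℕ-injective (Maybe.just-injective (trans (≡-sym ax≡k)
        (trans (≡-sym (updateAt-minimal x u a x≢u)) (w-mono l x (subst (_~ x) eq e~x)))))

      new-E : ∀ {e} → (∃[ k ] e ≡ w k) → E e
      new-E (k , refl) = w-E k

      disjoint : ∀ {e} → e ∈ tabulate w → e ∈ witnesses → _
      disjoint e∈new e∈old with ∈-tabulate⁻ e∈new
      ... | k , refl with coloured e∈old (blocked-adj (w-E k) (w-mono k))
      ...   | _ , au≡just with trans (≡-sym au≡∅) au≡just
      ...     | ()

      new-coloured : ∀ {e} → (∃[ k ] e ≡ w k) → ∀ x → e ~ x → Coloured (a [ u ≔ q + g ]) x
      new-coloured (k , refl) x e~x with x ≟ u
      ... | yes refl = q + g , updateAt-updates x a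
      ... | no  x≢u  = toℕ k , trans (updateAt-minimal x u a x≢u)
        (trans (≡-sym (updateAt-minimal x u a x≢u)) (w-mono k x e~x))

  initial : Partial
  initial v with U? v
  ... | yes _ = nothing
  ... | no  _ = just (base v)

  initial-state : State 0 initial
  initial-state = record
    { bounded   = λ {v} → bounded₀ v
    ; off       = λ {v} → off₀ v
    ; valid     = valid₀
    ; witnesses = []
    ; unique    = []
    ; ⊆E        = λ ()
    ; coloured  = λ ()
    ; size      = refl
    }
    where
    bounded₀ : ∀ v {i} → initial v ≡ just i → i < q + 0
    bounded₀ v eq with U? v
    bounded₀ v refl | no _ = subst (base v <_) (≡-sym (ℕ.+-identityʳ q)) (base< v)

    off₀ : ∀ v → ¬ U v → initial v ≡ just (base v)
    off₀ v ¬Uv with U? v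
    ... | yes Uv = contradiction Uv ¬Uv
    ... | no  _  = refl

    valid₀ : ∀ {e} → E e → ∀ i → ¬ Mono initial e i
    valid₀ Ee i mono with E-meets-U Ee
    ... | u , Uu , e~u with U? u | mono u e~u
    ...   | yes _  | ()
    ...   | no ¬Uu | _ = ¬Uu Uu

  -- Vertices already coloured are skipped. Those outside `U` are coloured from the start, so a run
  -- through `allFin n` assigns colours within `U` alone.
  run : ∀ us {g a} → State g a →
        ∃[ g′ ] ∃[ a′ ] (State g′ a′ × (∀ {v} → Coloured a v → Coloured a′ v) × (∀ {v} → v ∈ us → Coloured a′ v))
  run []       {g} {a} st = g , a , st , (λ c → c) , λ ()
  run (u ∷ us) {g} {a} st with a u in au
  ... | just i with run us st
  ...   | g′ , a′ , st′ , keep , done =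
    g′ , a′ , st′ , keep , λ { (here refl) → keep (i , au) ; (there v∈) → done v∈ }
  run (u ∷ us) {g} {a} st | nothing with step st au
  ... | g₁ , i , st₁ with run us st₁
  ...   | g′ , a′ , st′ , keep , done = g′ , a′ , st′ , keep ∘ coloured-mono {a} {u} i ,
    λ { (here refl) → keep (i , updateAt-updates u a) ; (there v∈) → done v∈ }

  record Result : Set where
    field
      new       : ℕ
      colour    : Fin n → ℕ
      bounded   : ∀ v → colour v < q + new
      off       : ∀ {v} → ¬ U v → colour v ≡ base v
      separates : ∀ {e} → E e → ∃[ u ] ∃[ w ] (e ~ u × e ~ w × colour u ≢ colour w)
      witnesses : List (Fin n)
      unique    : Unique witnesses
      ⊆E        : ∀ {e} → e ∈ witnesses → E e
      size      : length witnesses ≡ tri q new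

  result : Result
  result with run (allFin n) initial-state
  ... | g , a , st , _ , done = record
    { new       = g
    ; colour    = colour
    ; bounded   = λ v → State.bounded st (a≡ v)
    ; off       = λ {v} ¬Uv → Maybe.just-injective (trans (≡-sym (a≡ v)) (State.off st ¬Uv))
    ; separates = separates
    ; witnesses = State.witnesses st
    ; unique    = State.unique st
    ; ⊆E        = State.⊆E st
    ; size      = State.size st
    }
    where
    colour : Fin n → ℕ
    colour v = proj₁ (done (∈-allFin v))

    a≡ : ∀ v → a v ≡ just (colour v)
    a≡ v = proj₂ (done (∈-allFin v))

    separates : ∀ {e} → E e → ∃[ u ] ∃[ w ] (e ~ u × e ~ w × colour u ≢ colour w)
    separates {e} Ee with E-meets-U Ee
    ... | u , _ , e~u with any? (λ w → (e ~? w) ×-dec ¬? (colour u ℕ.≟ colour w))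
    ...   | yes (w , e~w , cu≢cw) = u , w , e~u , e~w , cu≢cw
    -- If no neighbour differs from `u` in colour, then `e` is monochromatic in the colour of `u`.
    ...   | no none = contradiction mono (State.valid st Ee (colour u))
      where
      mono : Mono a e (colour u)
      mono w e~w with colour u ℕ.≟ colour w
      ... | yes eq = trans (a≡ w) (cong just (≡-sym eq))
      ... | no neq = contradiction (w , e~w , neq) none

-- Minimal hitting sets of neighbourhoods.

module Hitting {n : ℕ} (G : Graph n) where

  open Adjacency G

  -- A hitting set ys for Z, with private members zs of Z certifying its minimality.
  record MinimalHittingSet (Z : Fin n → Set) (xs : List (Fin n)) : Set where
    field
      ys        : List (Fin n)
      zs        : List (Fin n)
      ys-unique : Unique ys
      zs-unique : Unique zs
      same-size : length ys ≡ length zs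
      ys⊆xs     : ∀ {y} → y ∈ ys → y ∈ xs
      zs⊆Z      : ∀ {z} → z ∈ zs → Z z
      hits      : ∀ {z} → Z z → ∃[ y ] (y ∈ ys × z ~ y)
      at-most-one  : ∀ {z y y′} → z ∈ zs → y ∈ ys → y′ ∈ ys → z ~ y → z ~ y′ → y ≡ y′
      needed    : ∀ {y} → y ∈ ys → ∃[ z ] (Z z × z ~ y)

  Hit : List (Fin n) → Fin n → Set
  Hit xs z = ∃[ y ] (y ∈ xs × z ~ y)

  hit? : ∀ xs → Decidable (Hit xs)
  hit? xs z = any? λ y → (y ∈? xs) ×-dec (z ~? y)

  -- By recursion on the candidates. If the later ones already hit all of `Z`, then `x` is dropped.
  -- Otherwise some `z₀` is hit by `x` alone; `x` is kept with `z₀` as its private member, and the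
  -- recursion goes on with the members of `Z` not adjacent to `x`. So later private members miss
  -- `x`, and `z₀` misses every later candidate.
  minimalHittingSet : ∀ {Z} → Decidable Z → ∀ xs → (∀ {z} → Z z → Hit xs z) → MinimalHittingSet Z xs
  minimalHittingSet Z? [] hits = record
    { ys = [] ; zs = [] ; ys-unique = [] ; zs-unique = [] ; same-size = refl
    ; ys⊆xs = λ () ; zs⊆Z = λ () ; hits = hits ; at-most-one = λ () ; needed = λ () }
  minimalHittingSet {Z} Z? (x ∷ xs) hits with any? (λ z → Z? z ×-dec ¬? (hit? xs z))
  ... | no all-hit = record
    { ys = ys ; zs = zs ; ys-unique = ys-unique ; zs-unique = zs-unique ; same-size = same-size
    ; ys⊆xs = there ∘ ys⊆xs ; zs⊆Z = zs⊆Z ; hits = hits′ ; at-most-one = at-most-one ; needed = needed }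
    where
    still-hit : ∀ {z} → Z z → Hit xs z
    still-hit {z} Zz with hit? xs z
    ... | yes h = h
    ... | no ¬h = contradiction (z , Zz , ¬h) all-hit
    open MinimalHittingSet (minimalHittingSet Z? xs still-hit) renaming (hits to hits′)
  ... | yes (z₀ , Zz₀ , ¬hit) = record
    { ys        = x ∷ ys
    ; zs        = z₀ ∷ zs
    ; ys-unique = All.tabulate (λ { y∈ refl → ¬hit (x , ys⊆xs y∈ , z₀~x) }) ∷ ys-unique
    ; zs-unique = All.tabulate (λ { z∈ refl → proj₂ (zs⊆Z z∈) z₀~x }) ∷ zs-unique
    ; same-size = cong suc same-size
    ; ys⊆xs     = λ { (here refl) → here refl ; (there y∈) → there (ys⊆xs y∈) }
    ; zs⊆Z      = λ { (here refl) → Zz₀ ; (there z∈) → proj₁ (zs⊆Z z∈) }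
    ; hits      = all-hit
    ; at-most-one  = only
    ; needed    = λ { (here refl) → z₀ , Zz₀ , z₀~x
                    ; (there y∈) → let z , (Zz , _) , z~y = needed y∈ in z , Zz , z~y }
    }
    where
    Z′ : Fin n → Set
    Z′ z = Z z × ¬ z ~ x

    hits-Z′ : ∀ {z} → Z′ z → Hit xs z
    hits-Z′ (Zz , z≁x) with hits Zz
    ... | y , here refl , z~x = contradiction z~x z≁x
    ... | y , there y∈ , z~y = y , y∈ , z~y

    z₀~x : z₀ ~ x
    z₀~x with hits Zz₀
    ... | y , here refl , z~x = z~x
    ... | y , there y∈ , z~y = contradiction (y , y∈ , z~y) ¬hit

    open MinimalHittingSet (minimalHittingSet {Z′} (λ z → Z? z ×-dec ¬? (z ~? x)) xs hits-Z′)
      renaming (hits to hits′)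

    all-hit : ∀ {z} → Z z → Hit (x ∷ ys) z
    all-hit {z} Zz with z ~? x
    ... | yes z~x = x , here refl , z~x
    ... | no  z≁x = let y , y∈ , z~y = hits′ (Zz , z≁x) in y , there y∈ , z~y

    only : ∀ {z y y′} → z ∈ z₀ ∷ zs → y ∈ x ∷ ys → y′ ∈ x ∷ ys → z ~ y → z ~ y′ → y ≡ y′
    only z∈          (here refl) (here refl) _   _    = refl
    only (here refl) (there y∈)  _           z~y _    = contradiction (_ , ys⊆xs y∈ , z~y) ¬hit
    only (here refl) _           (there y′∈) _   z~y′ = contradiction (_ , ys⊆xs y′∈ , z~y′) ¬hit
    only (there z∈)  (here refl) (there _)   z~x _    = contradiction z~x (proj₂ (zs⊆Z z∈))
    only (there z∈)  (there _)   (here refl) _   z~x  = contradiction z~x (proj₂ (zs⊆Z z∈))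
    only (there z∈)  (there y∈)  (there y′∈) z~y z~y′ = at-most-one z∈ y∈ y′∈ z~y z~y′

-- Greedy pairing into colour classes.

-- Greedy pairing of the members of a list into colour classes of size two, avoiding
-- conflicts; the unpaired rest conflicts pairwise, each of its members being alone
-- in its class.
module Pair {n : ℕ} {Conflict : Fin n → Fin n → Set}
  (conflict? : ∀ u v → Dec (Conflict u v))
  (conflict-sym : ∀ {u v} → Conflict u v → Conflict v u) where

  record Pairing (T : List (Fin n)) : Set where
    field
      k           : ℕ
      colour      : Fin n → ℕ
      bounded     : ∀ {v} → v ∈ T → colour v < k
      clash-free  : ∀ {u v} → u ∈ T → v ∈ T → u ≢ v → colour u ≡ colour v → ¬ Conflict u v
      small       : ∀ {u v w} → u ∈ T → v ∈ T → w ∈ T → u ≢ v → u ≢ w → v ≢ w →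
                    colour u ≡ colour v → colour u ≢ colour w
      rest        : List (Fin n)
      rest-unique : Unique rest
      rest⊆T      : ∀ {r} → r ∈ rest → r ∈ T
      conflicting : ∀ {u v} → u ∈ rest → v ∈ rest → u ≢ v → Conflict u v
      alone       : ∀ {r u} → r ∈ rest → u ∈ T → colour u ≡ colour r → u ≡ r
      -- A class of two is counted through both its members in `T`; a class of one through its
      -- member in `T` and again in `rest`.
      count       : k + k ≡ length T + length rest

  record Partner (t : Fin n) (R : List (Fin n)) : Set where
    field
      r       : Fin n
      r∈R     : r ∈ R
      free    : ¬ Conflict t r
      others  : List (Fin n)
      unique  : Unique others
      ⊆R      : ∀ {v} → v ∈ others → v ∈ R
      ∌r      : ∀ {v} → v ∈ others → v ≢ r
      size    : length R ≡ suc (length others)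

  partner : ∀ t {R} → Unique R → (∀ {r} → r ∈ R → Conflict t r) ⊎ Partner t R
  partner t [] = inj₁ λ ()
  partner t {r ∷ R} (r∉R ∷ uniq) with conflict? t r
  ... | no free = inj₂ record
    { r = r ; r∈R = here refl ; free = free ; others = R ; unique = uniq
    ; ⊆R = there ; ∌r = λ { v∈ refl → All.lookup r∉R v∈ refl } ; size = refl }
  ... | yes c with partner t uniq
  ...   | inj₁ cs = inj₁ λ { (here refl) → c ; (there r∈) → cs r∈ }
  ...   | inj₂ p = inj₂ record
    { r = P.r ; r∈R = there P.r∈R ; free = P.free ; others = r ∷ P.others
    ; unique = All.tabulate (λ v∈ → All.lookup r∉R (P.⊆R v∈)) ∷ P.unique
    ; ⊆R = λ { (here refl) → here refl ; (there v∈) → there (P.⊆R v∈) }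
    ; ∌r = λ { (here refl) → All.lookup r∉R P.r∈R ; (there v∈) → P.∌r v∈ }
    ; size = cong suc P.size }
    where module P = Partner p

  pairing : ∀ {T} → Unique T → Pairing T
  pairing [] = record
    { k = 0 ; colour = λ _ → 0 ; bounded = λ () ; clash-free = λ () ; small = λ ()
    ; rest = [] ; rest-unique = [] ; rest⊆T = λ () ; conflicting = λ () ; alone = λ () ; count = refl }
  pairing {t ∷ T} (t∉T ∷ uniq) = add (partner t rest-unique)
    where
    open Pairing (pairing uniq)

    module Recolour (i : ℕ) where
      colour′ : Fin n → ℕ
      colour′ = updateAt colour t (const i)

      at-t : colour′ t ≡ i
      at-t = updateAt-updates t colour

      at : ∀ {v} → v ∈ T → colour′ v ≡ colour v
      at {v} v∈ = updateAt-minimal v t colour λ { refl → All.lookup t∉T v∈ refl }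

      t-v : ∀ {v} → v ∈ T → colour′ t ≡ colour′ v → colour v ≡ i
      t-v v∈ eq = trans (≡-sym (at v∈)) (trans (≡-sym eq) at-t)

      u-v : ∀ {u v} → u ∈ T → v ∈ T → colour′ u ≡ colour′ v → colour u ≡ colour v
      u-v u∈ v∈ eq = trans (≡-sym (at u∈)) (trans eq (at v∈))

      clash-free′ : (∀ {v} → v ∈ T → colour v ≡ i → ¬ Conflict t v) →
        ∀ {u v} → u ∈ t ∷ T → v ∈ t ∷ T → u ≢ v → colour′ u ≡ colour′ v → ¬ Conflict u v
      clash-free′ ok (here refl) (here refl) u≢v _  = contradiction refl u≢v
      clash-free′ ok (here refl) (there v∈)  _   eq = ok v∈ (t-v v∈ eq)
      clash-free′ ok (there u∈)  (here refl) _   eq = ok u∈ (t-v u∈ (≡-sym eq)) ∘ conflict-sym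
      clash-free′ ok (there u∈)  (there v∈)  u≢v eq = clash-free u∈ v∈ u≢v (u-v u∈ v∈ eq)

      -- The premise says that the class `t` joins had at most one member: none for a fresh colour,
      -- only `r` for the colour of a partner `r`.
      small′ : (∀ {u v} → u ∈ T → v ∈ T → colour u ≡ i → colour v ≡ i → u ≡ v) →
        ∀ {u v w} → u ∈ t ∷ T → v ∈ t ∷ T → w ∈ t ∷ T → u ≢ v → u ≢ w → v ≢ w →
        colour′ u ≡ colour′ v → colour′ u ≢ colour′ w
      small′ ok (here refl) (here refl) _           u≢v _   _   _  _  = u≢v refl
      small′ ok (here refl) _           (here refl) _   u≢w _   _  _  = u≢w refl
      small′ ok _           (here refl) (here refl) _   _   v≢w _  _  = v≢w refl
      small′ ok (here refl) (there v∈)  (there w∈)  _   _   v≢w uv uw = v≢w (ok v∈ w∈ (t-v v∈ uv) (t-v w∈ uw))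
      small′ ok (there u∈)  (here refl) (there w∈)  _   u≢w _   uv uw =
        u≢w (ok u∈ w∈ (t-v u∈ (≡-sym uv)) (t-v w∈ (trans (≡-sym uv) uw)))
      small′ ok (there u∈)  (there v∈)  (here refl) u≢v _   _   uv uw =
        u≢v (ok u∈ v∈ (t-v u∈ (≡-sym uw)) (t-v v∈ (trans (≡-sym uw) uv)))
      small′ ok (there u∈)  (there v∈)  (there w∈)  u≢v u≢w v≢w uv uw =
        small u∈ v∈ w∈ u≢v u≢w v≢w (u-v u∈ v∈ uv) (u-v u∈ w∈ uw)

    -- Either `t` conflicts with all of `rest`, opens a class of its own and enters `rest`, or it
    -- shares the colour of a partner, which then leaves `rest` while `k` stays the same.
    add : (∀ {r} → r ∈ rest → Conflict t r) ⊎ Partner t rest → Pairing (t ∷ T)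
    add (inj₁ all-conflict) = record
      { k           = suc k
      ; colour      = colour′
      ; bounded     = λ { (here refl) → subst (_< suc k) (≡-sym at-t) (ℕ.n<1+n k)
                        ; (there v∈) → subst (_< suc k) (≡-sym (at v∈)) (ℕ.m<n⇒m<1+n (bounded v∈)) }
      ; clash-free  = clash-free′ λ v∈ eq → contradiction eq (fresh v∈)
      ; small       = small′ λ u∈ _ eq _ → contradiction eq (fresh u∈)
      ; rest        = t ∷ rest
      ; rest-unique = All.tabulate (λ r∈ → All.lookup t∉T (rest⊆T r∈)) ∷ rest-unique
      ; rest⊆T      = λ { (here refl) → here refl ; (there r∈) → there (rest⊆T r∈) }
      ; conflicting = λ { (here refl) (here refl) u≢v → contradiction refl u≢v
                        ; (here refl) (there v∈) _ → all-conflict v∈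
                        ; (there u∈) (here refl) _ → conflict-sym (all-conflict u∈)
                        ; (there u∈) (there v∈) → conflicting u∈ v∈ }
      ; alone       = λ { (here refl) (here refl) _ → refl
                        ; (here refl) (there u∈) eq → contradiction (t-v u∈ (≡-sym eq)) (fresh u∈)
                        ; (there r∈) (here refl) eq → contradiction (t-v (rest⊆T r∈) eq) (fresh (rest⊆T r∈))
                        ; (there r∈) (there u∈) eq → alone r∈ u∈ (u-v u∈ (rest⊆T r∈) eq) }
      ; count       = cong suc (trans (ℕ.+-suc k k)
                        (trans (cong suc count) (≡-sym (ℕ.+-suc (length T) (length rest)))))
      }
      where
      open Recolour k
      fresh : ∀ {v} → v ∈ T → colour v ≢ k
      fresh v∈ = ℕ.<⇒≢ (bounded v∈)
    add (inj₂ p) = record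
      { k           = k
      ; colour      = colour′
      ; bounded     = λ { (here refl) → subst (_< k) (≡-sym at-t) (bounded (rest⊆T r∈R))
                        ; (there v∈) → subst (_< k) (≡-sym (at v∈)) (bounded v∈) }
      ; clash-free  = clash-free′ λ v∈ eq c → free (subst (Conflict t) (alone r∈R v∈ eq) c)
      ; small       = small′ λ u∈ v∈ u≡ v≡ → trans (alone r∈R u∈ u≡) (≡-sym (alone r∈R v∈ v≡))
      ; rest        = others
      ; rest-unique = unique
      ; rest⊆T      = there ∘ rest⊆T ∘ ⊆R
      ; conflicting = λ u∈ v∈ → conflicting (⊆R u∈) (⊆R v∈)
      ; alone       = λ { r′∈ (here refl) eq →
                            contradiction (alone r∈R (rest⊆T (⊆R r′∈)) (t-v (rest⊆T (⊆R r′∈)) eq)) (∌r r′∈)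
                        ; r′∈ (there u∈) eq → alone (⊆R r′∈) u∈ (u-v u∈ (rest⊆T (⊆R r′∈)) eq) }
      ; count       = trans count (trans (cong (length T +_) size) (ℕ.+-suc (length T) (length others)))
      }
      where
      open Partner p
      open Recolour (colour r)

-- Recolouring a minimal hitting set.

-- Pairing up a minimal hitting set of Z.  Two non-adjacent unpaired vertices u, v are
-- linked by some z in Z with N(z) = {u, v}; such links differ from the private members
-- of Z, and removing one end of each link leaves a clique.
module Recolouring {n : ℕ} (G : Graph n) {Z : Fin n → Set} (Z? : Decidable Z)
  (Z-branching : ∀ {z} → Z z → Adjacency.Branching G z) where

  open Adjacency G
  open Hitting G

  SeesOnly : Fin n → Fin n → Fin n → Set
  SeesOnly u v z = Z z × z ~ u × z ~ v × (∀ w → z ~ w → w ≡ u ⊎ w ≡ v)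

  Linked : Fin n → Fin n → Set
  Linked u v = ∃[ z ] SeesOnly u v z

  linked? : ∀ u v → Dec (Linked u v)
  linked? u v = any? λ z → Z? z ×-dec (z ~? u) ×-dec (z ~? v) ×-dec
    all? λ w → (z ~? w) →-dec ((w ≟ u) ⊎-dec (w ≟ v))

  -- The two ways in which a shared colour does harm: an edge becomes improper, or some `z` with
  -- exactly these two neighbours sees one colour. A `z` with three neighbours is safe, since colour
  -- classes have at most two members.
  Conflict : Fin n → Fin n → Set
  Conflict u v = u ~ v ⊎ Linked u v

  conflict-sym : ∀ {u v} → Conflict u v → Conflict v u
  conflict-sym (inj₁ u~v) = inj₁ (~-sym u~v)
  conflict-sym (inj₂ (z , Zz , z~u , z~v , only)) = inj₂ (z , Zz , z~v , z~u , λ w z~w → swap (only w z~w))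

  open Pair (λ u v → (u ~? v) ⊎-dec linked? u v) conflict-sym

  record CliqueAndLinks (R : List (Fin n)) : Set where
    field
      clique       : List (Fin n)
      clique-uniq  : Unique clique
      clique⊆R     : ∀ {u} → u ∈ clique → u ∈ R
      clique-adj   : ∀ {u v} → u ∈ clique → v ∈ clique → u ≢ v → u ~ v
      links        : List (Fin n)
      links-unique : Unique links
      links-link   : ∀ {z} → z ∈ links → ∃[ u ] ∃[ v ] (u ∈ R × v ∈ R × u ≢ v × SeesOnly u v z)
      count        : length R ≡ length clique + length links

  -- If `r` is linked to a later member of the list, `r` is dropped and the link recorded. Otherwise
  -- its conflicts with the later members are all edges, so it joins the clique. A new link is
  -- adjacent to `r`, whereas an earlier one has both its neighbours in `R`, so links do not repeat.
  cliqueAndLinks : ∀ {R} → Unique R → (∀ {u v} → u ∈ R → v ∈ R → u ≢ v → Conflict u v) → CliqueAndLinks R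
  cliqueAndLinks [] _ = record
    { clique = [] ; clique-uniq = [] ; clique⊆R = λ () ; clique-adj = λ ()
    ; links = [] ; links-unique = [] ; links-link = λ () ; count = refl }
  cliqueAndLinks {r ∷ R} (r∉R ∷ uniq) conflicting = add (any? λ v → (v ∈? R) ×-dec linked? r v)
    where
    open CliqueAndLinks (cliqueAndLinks uniq λ u∈ v∈ → conflicting (there u∈) (there v∈))

    links-link′ : ∀ {z} → z ∈ links → ∃[ u ] ∃[ v ] (u ∈ r ∷ R × v ∈ r ∷ R × u ≢ v × SeesOnly u v z)
    links-link′ z∈ = let u , v , u∈ , v∈ , rest = links-link z∈ in u , v , there u∈ , there v∈ , rest

    links≁r : ∀ {z} → z ∈ links → ¬ z ~ r
    links≁r z∈ z~r with links-link z∈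
    ... | u , v , u∈ , v∈ , _ , _ , _ , _ , only with only r z~r
    ...   | inj₁ refl = All.lookup r∉R u∈ refl
    ...   | inj₂ refl = All.lookup r∉R v∈ refl

    add : Dec (∃[ v ] (v ∈ R × Linked r v)) → CliqueAndLinks (r ∷ R)
    add (yes (v , v∈ , z , l@(_ , z~r , _))) = record
      { clique       = clique
      ; clique-uniq  = clique-uniq
      ; clique⊆R     = there ∘ clique⊆R
      ; clique-adj   = clique-adj
      ; links        = z ∷ links
      ; links-unique = All.tabulate (λ { z∈ refl → links≁r z∈ z~r }) ∷ links-unique
      ; links-link   = λ { (here refl) → r , v , here refl , there v∈ , All.lookup r∉R v∈ , l
                         ; (there z∈) → links-link′ z∈ }
      ; count        = trans (cong suc count) (≡-sym (ℕ.+-suc (length clique) (length links)))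
      }
    add (no unlinked) = record
      { clique       = r ∷ clique
      ; clique-uniq  = All.tabulate (λ u∈ → All.lookup r∉R (clique⊆R u∈)) ∷ clique-uniq
      ; clique⊆R     = λ { (here refl) → here refl ; (there u∈) → there (clique⊆R u∈) }
      ; clique-adj   = λ { (here refl) (here refl) u≢v → contradiction refl u≢v
                         ; (here refl) (there v∈) _ → r~ v∈
                         ; (there u∈) (here refl) _ → ~-sym (r~ u∈)
                         ; (there u∈) (there v∈) → clique-adj u∈ v∈ }
      ; links        = links
      ; links-unique = links-unique
      ; links-link   = links-link′
      ; count        = cong suc count
      }
      where
      r~ : ∀ {v} → v ∈ clique → r ~ v
      r~ v∈ with conflicting (here refl) (there (clique⊆R v∈)) (All.lookup r∉R (clique⊆R v∈))
      ... | inj₁ r~v = r~v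
      ... | inj₂ l   = contradiction (_ , clique⊆R v∈ , l) unlinked

  hitting : MinimalHittingSet Z (allFin n)
  hitting = minimalHittingSet Z? (allFin n) λ Zz → let u , _ , z~u , _ = Z-branching Zz in u , ∈-allFin u , z~u

  module H = MinimalHittingSet hitting
  module P = Pairing (pairing H.ys-unique)
  module L = CliqueAndLinks (cliqueAndLinks P.rest-unique P.conflicting)

  open P public using (k; colour; bounded)
  open H public using (needed)
  open L public using (clique; clique-uniq; clique-adj)

  recoloured : List (Fin n)
  recoloured = H.ys

  proper : ∀ {u v} → u ∈ recoloured → v ∈ recoloured → u ~ v → colour u ≢ colour v
  proper u∈ v∈ u~v eq = P.clash-free u∈ v∈ (λ { refl → ~-irrefl u~v }) eq (inj₁ u~v)

  -- The colours of `w` are compared only if `w` is recoloured; otherwise `t` and `w` will lie in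
  -- disjoint palettes. If a second neighbour `t′` is recoloured too, either `z` sees nothing else
  -- and links `t` to `t′`, or it has a third neighbour and `small` applies.
  separates : ∀ {z} → Z z → ∃[ t ] ∃[ w ] (z ~ t × z ~ w × t ∈ recoloured × (w ∈ recoloured → colour t ≢ colour w))
  separates {z} Zz with H.hits Zz
  ... | t , t∈ , z~t with another (Z-branching Zz) t
  ... | t′ , z~t′ , t′≢t with t′ ∈? recoloured
  ... | no t′∉ = t , t′ , z~t , z~t′ , t∈ , λ t′∈ → contradiction t′∈ t′∉
  ... | yes t′∈ with any? (λ w → (z ~? w) ×-dec ¬? (w ≟ t) ×-dec ¬? (w ≟ t′))
  ... | no none = t , t′ , z~t , z~t′ , t∈ , λ _ eq →
    P.clash-free t∈ t′∈ (t′≢t ∘ ≡-sym) eq (inj₂ (z , Zz , z~t , z~t′ , only))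
    where
    only : ∀ w → z ~ w → w ≡ t ⊎ w ≡ t′
    only w z~w with w ≟ t | w ≟ t′
    ... | yes w≡t | _        = inj₁ w≡t
    ... | no _    | yes w≡t′ = inj₂ w≡t′
    ... | no w≢t  | no w≢t′  = contradiction (w , z~w , w≢t , w≢t′) none
  ... | yes (w , z~w , w≢t , w≢t′) with colour t ℕ.≟ colour t′
  ...   | no neq = t , t′ , z~t , z~t′ , t∈ , λ _ → neq
  ...   | yes eq = t , w , z~t , z~w , t∈ , λ w∈ →
    P.small t∈ t′∈ w∈ (t′≢t ∘ ≡-sym) (w≢t ∘ ≡-sym) (w≢t′ ∘ ≡-sym) eq

  witnesses : List (Fin n)
  witnesses = H.zs ++ L.links

  witnesses-unique : Unique witnesses
  witnesses-unique = Unique.++⁺ H.zs-unique L.links-unique λ (z∈zs , z∈links) →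
    let _ , _ , u∈ , v∈ , u≢v , _ , z~u , z~v , _ = L.links-link z∈links
    -- A link sees two distinct members of the hitting set, a private member at most one.
    in u≢v (H.at-most-one z∈zs (P.rest⊆T u∈) (P.rest⊆T v∈) z~u z~v)

  witnesses⊆Z : ∀ {z} → z ∈ witnesses → Z z
  witnesses⊆Z z∈ with ∈-++⁻ H.zs z∈
  ... | inj₁ z∈zs = H.zs⊆Z z∈zs
  ... | inj₂ z∈links = let _ , _ , _ , _ , _ , Zz , _ = L.links-link z∈links in Zz

  count : k + k ≡ length witnesses + length clique
  count = begin
    k + k                                              ≡⟨ P.count ⟩
    length H.ys + length P.rest                        ≡⟨ cong₂ _+_ H.same-size L.count ⟩
    length H.zs + (length clique + length L.links)     ≡⟨ cong (length H.zs +_) (ℕ.+-comm (length clique) _) ⟩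
    length H.zs + (length L.links + length clique)     ≡⟨ ℕ.+-assoc (length H.zs) _ _ ⟨
    (length H.zs + length L.links) + length clique     ≡⟨ cong (_+ length clique) (length-++ H.zs) ⟨
    length witnesses + length clique                   ∎
    where open ≡-Reasoning

-- From lists to subsets, and maximum independent sets.

module _ {n : ℕ} where

  ⊆-length : ∀ {xs} → Unique xs → {p : Subset n} → (∀ {x} → x ∈ xs → x Subset.∈ p) → length xs ≤ ∣ p ∣
  ⊆-length []             _    = z≤n
  ⊆-length (x∉xs ∷ uniq) {p} xs⊆p = ℕ.≤-<-trans
    (⊆-length uniq {p Subset.- _} λ y∈ → x∈p∧x≢y⇒x∈p-y (xs⊆p (there y∈)) λ { refl → All.lookup x∉xs y∈ refl })
    (x∈p⇒∣p-x∣<∣p∣ (xs⊆p (here refl)))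

  fromList : List (Fin n) → Subset n
  fromList xs = Vec.tabulate λ v → does (v ∈? xs)

  ∈-fromList⁺ : ∀ {xs v} → v ∈ xs → v Subset.∈ fromList xs
  ∈-fromList⁺ {xs} {v} v∈ = Vec.lookup⇒[]= v (fromList xs)
    (trans (Vec.lookup∘tabulate _ v) (dec-true (v ∈? xs) v∈))

  ∈-fromList⁻ : ∀ {xs v} → v Subset.∈ fromList xs → v ∈ xs
  ∈-fromList⁻ {xs} {v} v∈ with v ∈? xs | trans (≡-sym (Vec.lookup∘tabulate (λ u → does (u ∈? xs)) v)) (Vec.[]=⇒lookup v∈)
  ... | yes v∈xs | _ = v∈xs

  module _ (G : Graph n) where
    open Adjacency G

    independent-length : ∀ {α} → (∀ S → Independent G S → ∣ S ∣ ≤ α) → ∀ {xs} → Unique xs →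
      (∀ {u v} → u ∈ xs → v ∈ xs → ¬ u ~ v) → length xs ≤ α
    independent-length bound uniq indep = ℕ.≤-trans (⊆-length uniq ∈-fromList⁺)
      (bound _ λ u v u∈ v∈ → Bool.¬-not (indep (∈-fromList⁻ u∈) (∈-fromList⁻ v∈)))

    clique-length : ∀ {ω} → (∀ S → Clique G S → ∣ S ∣ ≤ ω) → ∀ {xs} → Unique xs →
      (∀ {u v} → u ∈ xs → v ∈ xs → u ≢ v → u ~ v) → length xs ≤ ω
    clique-length bound uniq adjacent = ℕ.≤-trans (⊆-length uniq ∈-fromList⁺)
      (bound _ λ u v u∈ v∈ → adjacent (∈-fromList⁻ u∈) (∈-fromList⁻ v∈))

    private
      degreeIn : Fin n → List (Fin n) → ℕ
      degreeIn v us = sum (map (λ u → if adj G v u then 1 else 0) us)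

      neighbourIn : ∀ v us → 1 ≤ degreeIn v us → ∃[ u ] (u ∈ us × v ~ u)
      neighbourIn v (u ∷ us) 1≤d with adj G v u in eq
      ... | true  = u , here refl , eq
      ... | false = let w , w∈ , v~w = neighbourIn v us 1≤d in w , there w∈ , v~w

      branchingIn : ∀ v {us} → Unique us → 2 ≤ degreeIn v us → Branching v
      branchingIn v {u ∷ us} (u∉us ∷ uniq) 2≤d with adj G v u in eq
      ... | true  = let w , w∈ , v~w = neighbourIn v us (s≤s⁻¹ 2≤d) in u , w , eq , v~w , All.lookup u∉us w∈
      ... | false = branchingIn v uniq 2≤d

    2≤degree⇒branching : ∀ {v} → 2 ≤ degree G v → Branching v
    2≤degree⇒branching {v} = branchingIn v (Unique.allFin⁺ n)

    module MaximumIndependent {S : Subset n} (indep : Independent G S)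
      (maximum : ∀ S′ → Independent G S′ → ∣ S′ ∣ ≤ ∣ S ∣) where

      -- Otherwise `v` could be added to `S`, against maximality.
      dominating : ∀ {v} → v Subset.∉ S → ∃[ u ] (u Subset.∈ S × v ~ u)
      dominating {v} v∉S with any? (λ u → (u ∈S? S) ×-dec (v ~? u))
      ... | yes found = found
      ... | no none = contradiction (maximum (S ∪ ⁅ v ⁆) indep′)
        (ℕ.<⇒≱ (p⊂q⇒∣p∣<∣q∣ (p⊆p∪q ⁅ v ⁆ , v , x∈p∪q⁺ (inj₂ (x∈⁅x⁆ v)) , v∉S)))
        where
        v≁S : ∀ {u} → u Subset.∈ S → adj G v u ≡ false
        v≁S u∈ = Bool.¬-not λ v~u → none (_ , u∈ , v~u)

        indep′ : Independent G (S ∪ ⁅ v ⁆)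
        indep′ a b a∈ b∈ with x∈p∪q⁻ S ⁅ v ⁆ a∈ | x∈p∪q⁻ S ⁅ v ⁆ b∈
        ... | inj₁ a∈S | inj₁ b∈S = indep a b a∈S b∈S
        ... | inj₁ a∈S | inj₂ b∈v with x∈⁅y⁆⇒x≡y v b∈v
        ...   | refl = trans (sym G a v) (v≁S a∈S)
        indep′ a b a∈ b∈ | inj₂ a∈v | inj₁ b∈S with x∈⁅y⁆⇒x≡y v a∈v
        ...   | refl = v≁S b∈S
        indep′ a b a∈ b∈ | inj₂ a∈v | inj₂ b∈v with x∈⁅y⁆⇒x≡y v a∈v | x∈⁅y⁆⇒x≡y v b∈v
        ...   | refl | refl = irrefl G v

-- Arithmetic of the colour count.

-- Here `tri 1 g` is the triangular number g(g+1)/2. Its increment `1 + g` reaches 4 at g = 3, where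
-- induction starts; the constant 6 is attained at g = 3 and g = 4.
tri₁-bound : ∀ g → 4 * g ≤ tri 1 g + 6
tri₁-bound 0 = z≤n
tri₁-bound 1 = toWitness {a? = 4 ℕ.≤? 7} _
tri₁-bound 2 = toWitness {a? = 8 ℕ.≤? 9} _
tri₁-bound (suc (suc (suc g))) = go g
  where
  go : ∀ g → 4 * (3 + g) ≤ tri 1 (3 + g) + 6
  go zero    = ℕ.≤-refl
  go (suc g) = begin
    4 * suc (3 + g)                 ≡⟨ ℕ.*-suc 4 (3 + g) ⟩
    4 + 4 * (3 + g)                 ≤⟨ ℕ.+-mono-≤ (ℕ.m≤m+n 4 g) (go g) ⟩
    (4 + g) + (tri 1 (3 + g) + 6)   ≡⟨ solve 2 (λ x t → x :+ (t :+ con 6) := t :+ x :+ con 6) refl (4 + g) (tri 1 (3 + g)) ⟩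
    tri 1 (3 + g) + (4 + g) + 6     ∎
    where open ℕ.≤-Reasoning

-- The increment `q + g` is at least 4 from g = 2 on, where induction starts. For q = 2 the constant
-- 3 is attained there.
tri₂-bound : ∀ {q} → 2 ≤ q → ∀ g → 4 * g ≤ tri q g + 3
tri₂-bound _   zero    = z≤n
tri₂-bound 2≤q (suc zero) = ℕ.+-monoˡ-≤ 3 (ℕ.≤-trans (s≤s z≤n) (ℕ.≤-trans 2≤q (ℕ.m≤m+n _ 0)))
tri₂-bound {q} 2≤q (suc (suc g)) = go g
  where
  go : ∀ g → 4 * (2 + g) ≤ tri q (2 + g) + 3
  go zero    = begin
    8                        ≡⟨⟩
    (2 + 0) + (2 + 1) + 3    ≤⟨ ℕ.+-monoˡ-≤ 3 (ℕ.+-mono-≤ (ℕ.+-monoˡ-≤ 0 2≤q) (ℕ.+-monoˡ-≤ 1 2≤q)) ⟩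
    (q + 0) + (q + 1) + 3    ∎
    where open ℕ.≤-Reasoning
  go (suc g) = begin
    4 * suc (2 + g)                     ≡⟨ ℕ.*-suc 4 (2 + g) ⟩
    4 + 4 * (2 + g)                     ≤⟨ ℕ.+-mono-≤ (ℕ.+-mono-≤ 2≤q (ℕ.m≤m+n 2 g)) (go g) ⟩
    (q + (2 + g)) + (tri q (2 + g) + 3) ≡⟨ solve 2 (λ x t → x :+ (t :+ con 3) := t :+ x :+ con 3) refl (q + (2 + g)) (tri q (2 + g)) ⟩
    tri q (2 + g) + (q + (2 + g)) + 3   ∎
    where open ℕ.≤-Reasoning

-- Adding the two bounds by `α` gives 4(g + h) + 2r ≤ 2α + 9. After halving, the one colour beyond
-- `g` adds 2 to the constant and `s` is absorbed by `ω`.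
colour-count : ∀ χ {α ω a b r s k g h} → 4 * g ≤ a + 6 → 4 * h ≤ b + 3 →
  a + r ≤ α → b + r ≤ α → s ≤ ω → k + k ≡ r + s →
  2 * (χ + h + suc g + k) ≤ 2 * χ + α + ω + 6
colour-count χ {α} {ω} {a} {b} {r} {s} {k} {g} {h} 4g≤ 4h≤ a+r≤ b+r≤ s≤ω 2k≡ = begin
  2 * (χ + h + suc g + k)                   ≡⟨ solve 4 (λ x h g k → con 2 :* (x :+ h :+ (con 1 :+ g) :+ k)
                                                 := con 2 :* x :+ (con 2 :* (g :+ h) :+ con 2 :+ (k :+ k))) refl χ h g k ⟩
  2 * χ + (2 * (g + h) + 2 + (k + k))       ≡⟨ cong (λ m → 2 * χ + (2 * (g + h) + 2 + m)) 2k≡ ⟩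
  2 * χ + (2 * (g + h) + 2 + (r + s))       ≡⟨ solve 4 (λ x m r s → x :+ (m :+ con 2 :+ (r :+ s))
                                                 := x :+ (m :+ r) :+ s :+ con 2) refl (2 * χ) (2 * (g + h)) r s ⟩
  2 * χ + (2 * (g + h) + r) + s + 2         ≤⟨ ℕ.+-monoˡ-≤ 2 (ℕ.+-mono-≤ (ℕ.+-monoʳ-≤ (2 * χ) main) s≤ω) ⟩
  2 * χ + (α + 4) + ω + 2                   ≡⟨ solve 3 (λ x α ω → x :+ (α :+ con 4) :+ ω :+ con 2
                                                 := x :+ α :+ ω :+ con 6) refl (2 * χ) α ω ⟩
  2 * χ + α + ω + 6                         ∎
  where
  open ℕ.≤-Reasoning

  doubled : 2 * (2 * (g + h) + r) < 2 * (α + 5)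
  doubled = begin-strict
    2 * (2 * (g + h) + r)            ≡⟨ solve 3 (λ g h r → con 2 :* (con 2 :* (g :+ h) :+ r)
                                          := con 4 :* g :+ con 4 :* h :+ (r :+ r)) refl g h r ⟩
    4 * g + 4 * h + (r + r)          ≤⟨ ℕ.+-monoˡ-≤ (r + r) (ℕ.+-mono-≤ 4g≤ 4h≤) ⟩
    (a + 6) + (b + 3) + (r + r)      ≡⟨ solve 3 (λ a b r → a :+ con 6 :+ (b :+ con 3) :+ (r :+ r)
                                          := a :+ r :+ (b :+ r) :+ con 9) refl a b r ⟩
    (a + r) + (b + r) + 9            ≤⟨ ℕ.+-monoˡ-≤ 9 (ℕ.+-mono-≤ a+r≤ b+r≤) ⟩
    -- As 9 is odd, the strict bound by 2(α + 5) halves to α + 4, not α + 5.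
    α + α + 9                        <⟨ ℕ.+-monoʳ-< (α + α) (ℕ.n<1+n 9) ⟩
    α + α + 10                       ≡⟨ solve 1 (λ α → α :+ α :+ con 10 := con 2 :* (α :+ con 5)) refl α ⟩
    2 * (α + 5)                      ∎

  main : 2 * (g + h) + r ≤ α + 4
  main = ℕ.<⇒≤pred (subst (2 * (g + h) + r <_) (ℕ.+-suc α 4) (ℕ.*-cancelˡ-< 2 _ _ doubled))

-- The dynamic colouring and the size of its palette.

module Construction {n χ : ℕ} (G : Graph n) (2≤χ : 2 ≤ χ)
  (c : Fin n → Fin χ) (c-proper : Proper G χ c)
  {S : Subset n} (indep : Independent G S)
  (maximum : ∀ S′ → Independent G S′ → ∣ S′ ∣ ≤ ∣ S ∣) where

  open Adjacency G
  open MaximumIndependent G indep maximum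

  InS X M Z : Fin n → Set
  InS v = v Subset.∈ S
  X v = ¬ InS v × Branching v × (∀ u → v ~ u → InS u)
  M v = InS v × Branching v × ∃[ u ] (X u × v ~ u)
  Z v = InS v × Branching v × (∀ u → v ~ u → ¬ X u)

  X? : Decidable X
  X? v = ¬? (v ∈S? S) ×-dec branching? v ×-dec all? λ u → (v ~? u) →-dec (u ∈S? S)

  M? : Decidable M
  M? v = (v ∈S? S) ×-dec branching? v ×-dec any? λ u → X? u ×-dec (v ~? u)

  Z? : Decidable Z
  Z? v = (v ∈S? S) ×-dec branching? v ×-dec all? λ u → (v ~? u) →-dec ¬? (X? u)

  S≁S : ∀ {u v} → InS u → InS v → ¬ u ~ v
  S≁S u∈ v∈ u~v with trans (≡-sym u~v) (indep _ _ u∈ v∈)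
  ... | ()

  -- On `S` the old colours give way to a single base colour, hence `q = 1` and `suc A.new` colours
  -- altogether.
  module A = FirstFit.Result (FirstFit.result G X? (_∈S? S) (const 0) 1 (λ _ → s≤s z≤n)
    (λ (_ , br , _) → br)
    (λ (_ , (u , _ , e~u , _) , N⊆S) → u , N⊆S u e~u , e~u))

  -- Any colours may be given to `X`: its neighbours all lie in `S`, which has a palette of its own.
  module B = FirstFit.Result (FirstFit.result G M? X? (toℕ ∘ c) χ (toℕ<n ∘ c)
    (λ (_ , br , _) → br) (λ (_ , _ , m) → m))

  module C = Recolouring G Z? (λ (_ , br , _) → br)

  -- Three consecutive palettes: `χ + B.new` colours for `B`, then `suc A.new` for `S`, then `C.k`
  -- for the hitting set.
  total : ℕ
  total = χ + B.new + suc A.new + C.k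

  recoloured∉S : ∀ {v} → v ∈ C.recoloured → ¬ InS v
  recoloured∉S v∈ v∈S = let _ , (z∈S , _) , z~v = C.needed v∈ in S≁S z∈S v∈S z~v

  recoloured∉X : ∀ {v} → v ∈ C.recoloured → ¬ X v
  recoloured∉X v∈ = let _ , (_ , _ , ≁X) , z~v = C.needed v∈ in ≁X _ z~v

  abstract
    final : Fin n → ℕ
    final v with v ∈S? S | v ∈? C.recoloured
    ... | yes _ | _     = χ + B.new + A.colour v
    ... | no  _ | yes _ = χ + B.new + suc A.new + C.colour v
    ... | no  _ | no  _ = B.colour v

    final-S : ∀ {v} → InS v → final v ≡ χ + B.new + A.colour v
    final-S {v} v∈S with v ∈S? S | v ∈? C.recoloured
    ... | yes _  | _ = refl
    ... | no v∉S | _ = contradiction v∈S v∉S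

    final-recoloured : ∀ {v} → v ∈ C.recoloured → final v ≡ χ + B.new + suc A.new + C.colour v
    final-recoloured {v} v∈ with v ∈S? S | v ∈? C.recoloured
    ... | yes v∈S | _      = contradiction v∈S (recoloured∉S v∈)
    ... | no _    | yes _  = refl
    ... | no _    | no v∉  = contradiction v∈ v∉

    final-rest : ∀ {v} → ¬ InS v → ¬ v ∈ C.recoloured → final v ≡ B.colour v
    final-rest {v} v∉S v∉ with v ∈S? S | v ∈? C.recoloured
    ... | yes v∈S | _      = contradiction v∈S v∉S
    ... | no _    | yes v∈ = contradiction v∈ v∉
    ... | no _    | no _   = refl

    final-bounded : ∀ v → final v < total
    final-bounded v with v ∈S? S | v ∈? C.recoloured
    ... | yes _ | _      = ℕ.<-≤-trans (ℕ.+-monoʳ-< (χ + B.new) (A.bounded v)) (ℕ.m≤m+n _ C.k)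
    ... | no  _ | yes v∈ = ℕ.+-monoʳ-< (χ + B.new + suc A.new) (C.bounded v∈)
    ... | no  _ | no  _  = ℕ.<-≤-trans (B.bounded v)
      (ℕ.≤-trans (ℕ.m≤m+n _ (suc A.new)) (ℕ.m≤m+n _ C.k))

  separated : ∀ {x y m} → x < m → m ≤ y → x ≢ y
  separated x<m m≤y = ℕ.<⇒≢ (ℕ.<-≤-trans x<m m≤y)

  S-recoloured : ∀ {u v} → InS u → v ∈ C.recoloured → final u ≢ final v
  S-recoloured {u} u∈S v∈ eq = separated (ℕ.+-monoʳ-< (χ + B.new) (A.bounded u)) (ℕ.m≤m+n _ _)
    (trans (≡-sym (final-S u∈S)) (trans eq (final-recoloured v∈)))

  rest-S : ∀ {u v} → ¬ InS u → ¬ u ∈ C.recoloured → InS v → final u ≢ final v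
  rest-S {u} u∉S u∉ v∈S eq = separated (B.bounded u) (ℕ.m≤m+n _ _)
    (trans (≡-sym (final-rest u∉S u∉)) (trans eq (final-S v∈S)))

  rest-recoloured : ∀ {u v} → ¬ InS u → ¬ u ∈ C.recoloured → v ∈ C.recoloured → final u ≢ final v
  rest-recoloured {u} u∉S u∉ v∈ eq =
    separated (B.bounded u) (ℕ.≤-trans (ℕ.m≤m+n _ (suc A.new)) (ℕ.m≤m+n _ _))
      (trans (≡-sym (final-rest u∉S u∉)) (trans eq (final-recoloured v∈)))

  S-nonS : ∀ {u v} → InS u → ¬ InS v → final u ≢ final v
  S-nonS {u} {v} u∈S v∉S with v ∈? C.recoloured
  ... | yes v∈ = S-recoloured u∈S v∈
  ... | no  v∉ = rest-S v∉S v∉ u∈S ∘ ≡-sym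

  S-S : ∀ {u v} → InS u → InS v → A.colour u ≢ A.colour v → final u ≢ final v
  S-S u∈S v∈S neq eq = neq (ℕ.+-cancelˡ-≡ (χ + B.new) _ _
    (trans (≡-sym (final-S u∈S)) (trans eq (final-S v∈S))))

  rest-rest : ∀ {u v} → ¬ InS u → ¬ u ∈ C.recoloured → ¬ InS v → ¬ v ∈ C.recoloured →
              B.colour u ≢ B.colour v → final u ≢ final v
  rest-rest u∉S u∉ v∉S v∉ neq eq = neq
    (trans (≡-sym (final-rest u∉S u∉)) (trans eq (final-rest v∉S v∉)))

  recoloured-recoloured : ∀ {u v} → u ∈ C.recoloured → v ∈ C.recoloured →
                          C.colour u ≢ C.colour v → final u ≢ final v
  recoloured-recoloured u∈ v∈ neq eq = neq (ℕ.+-cancelˡ-≡ (χ + B.new + suc A.new) _ _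
    (trans (≡-sym (final-recoloured u∈)) (trans eq (final-recoloured v∈))))

  proper : ∀ {u v} → u ~ v → final u ≢ final v
  proper {u} {v} u~v with u ∈S? S | v ∈S? S
  ... | yes u∈S | yes v∈S = contradiction u~v (S≁S u∈S v∈S)
  ... | yes u∈S | no v∉S  = S-nonS u∈S v∉S
  ... | no u∉S  | yes v∈S = S-nonS v∈S u∉S ∘ ≡-sym
  ... | no u∉S  | no v∉S with u ∈? C.recoloured | v ∈? C.recoloured
  ...   | yes u∈ | yes v∈ = recoloured-recoloured u∈ v∈ (C.proper u∈ v∈ u~v)
  ...   | yes u∈ | no v∉  = rest-recoloured v∉S v∉ u∈ ∘ ≡-sym
  ...   | no u∉  | yes v∈ = rest-recoloured u∉S u∉ v∈
  -- An edge outside `S` has no end in `X`, so both ends still carry the colours of `c`.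
  ...   | no u∉  | no v∉  = rest-rest u∉S u∉ v∉S v∉ λ eq → c-proper u v u~v (toℕ-injective
    (trans (≡-sym (B.off u∉X)) (trans eq (B.off v∉X))))
    where
    u∉X : ¬ X u
    u∉X (_ , _ , N⊆S) = v∉S (N⊆S v u~v)
    v∉X : ¬ X v
    v∉X (_ , _ , N⊆S) = u∉S (N⊆S u (~-sym u~v))

  dynamic : ∀ {v} → Branching v → ∃[ u ] ∃[ w ] (v ~ u × v ~ w × final u ≢ final w)
  dynamic {v} br with v ∈S? S
  dynamic {v} br | no v∉S with X? v
  ... | yes Xv@(_ , _ , N⊆S) =
    let u , w , v~u , v~w , neq = A.separates Xv
    in u , w , v~u , v~w , S-S (N⊆S u v~u) (N⊆S w v~w) neq
  ... | no ¬Xv with any? (λ w → (v ~? w) ×-dec ¬? (w ∈S? S)) | dominating v∉S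
  ...   | yes (w , v~w , w∉S) | u , u∈S , v~u = u , w , v~u , v~w , S-nonS u∈S w∉S
  ...   | no none | _ = contradiction (v∉S , br , N⊆S) ¬Xv
    where
    N⊆S : ∀ u → v ~ u → InS u
    N⊆S u v~u with u ∈S? S
    ... | yes u∈S = u∈S
    ... | no u∉S  = contradiction (u , v~u , u∉S) none
  dynamic {v} br | yes v∈S with any? (λ u → X? u ×-dec (v ~? u))
  ... | no ≁X =
    let t , w , v~t , v~w , t∈ , differ = C.separates (v∈S , br , λ u v~u Xu → ≁X (u , Xu , v~u))
    in t , w , v~t , v~w , t-w t∈ v~w differ
    where
    t-w : ∀ {t w} → t ∈ C.recoloured → v ~ w → (w ∈ C.recoloured → C.colour t ≢ C.colour w) → final t ≢ final w
    t-w {w = w} t∈ v~w differ with w ∈? C.recoloured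
    ... | yes w∈ = recoloured-recoloured t∈ w∈ (differ w∈)
    ... | no w∉  = rest-recoloured (λ w∈S → S≁S v∈S w∈S v~w) w∉ t∈ ∘ ≡-sym
  ... | yes (x , Xx@(x∉S , _) , v~x) with B.separates (v∈S , br , x , Xx , v~x)
  ...   | u , w , v~u , v~w , neq with u ∈? C.recoloured | w ∈? C.recoloured
  -- The hitting set may have overwritten a colour that `B` relied on. The neighbour `x` in `X` is
  -- never overwritten, so it differs from the overwritten vertex.
  ...     | yes u∈ | _      = x , u , v~x , v~u , rest-recoloured x∉S (λ x∈ → recoloured∉X x∈ Xx) u∈
  ...     | no _   | yes w∈ = x , w , v~x , v~w , rest-recoloured x∉S (λ x∈ → recoloured∉X x∈ Xx) w∈
  ...     | no u∉  | no w∉  = u , w , v~u , v~w ,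
    rest-rest (λ u∈S → S≁S v∈S u∈S v~u) u∉ (λ w∈S → S≁S v∈S w∈S v~w) w∉ neq

  dynColourable : DynColourable G total
  dynColourable = (λ v → fromℕ< (final-bounded v)) ,
    (λ u v u~v → lift (proper u~v)) ,
    λ v 2≤d → let u , w , v~u , v~w , neq = dynamic (2≤degree⇒branching G 2≤d)
              in u , w , v~u , v~w , lift neq
    where
    lift : ∀ {u v} → final u ≢ final v → fromℕ< (final-bounded u) ≢ fromℕ< (final-bounded v)
    lift neq eq = neq (fromℕ<-injective _ _ _ _ eq)

  module _ {W : Fin n → Set} (ws : List (Fin n)) (ws⊆W : ∀ {v} → v ∈ ws → W v)
    (W∩Z : ∀ {v} → W v → ¬ Z v) (W≁W : ∀ {u v} → W u → W v → ¬ u ~ v)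
    (W≁Z : ∀ {u v} → W u → Z v → ¬ v ~ u) where

    -- Applied with `W` as `X` and as `M`; it lets the witnesses in `Z` count against the
    -- independence number twice, once beside those of `A` and once beside those of `B`.
    count-with-Z : Unique ws → length ws + length C.witnesses ≤ ∣ S ∣
    count-with-Z uniq = subst (_≤ ∣ S ∣) (length-++ ws) (independent-length G maximum
      (Unique.++⁺ uniq C.witnesses-unique λ (v∈ws , v∈) → W∩Z (ws⊆W v∈ws) (C.witnesses⊆Z v∈))
      λ u∈ v∈ → apart (∈-++⁻ ws u∈) (∈-++⁻ ws v∈))
      where
      apart : ∀ {u v} → u ∈ ws ⊎ u ∈ C.witnesses → v ∈ ws ⊎ v ∈ C.witnesses → ¬ u ~ v
      apart (inj₁ u∈) (inj₁ v∈) = W≁W (ws⊆W u∈) (ws⊆W v∈)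
      apart (inj₁ u∈) (inj₂ v∈) = W≁Z (ws⊆W u∈) (C.witnesses⊆Z v∈) ∘ ~-sym
      apart (inj₂ u∈) (inj₁ v∈) = W≁Z (ws⊆W v∈) (C.witnesses⊆Z u∈)
      apart (inj₂ u∈) (inj₂ v∈) = S≁S (proj₁ (C.witnesses⊆Z u∈)) (proj₁ (C.witnesses⊆Z v∈))

  X-count : tri 1 A.new + length C.witnesses ≤ ∣ S ∣
  X-count = subst (λ m → m + length C.witnesses ≤ ∣ S ∣) A.size (count-with-Z A.witnesses A.⊆E
    (λ (v∉S , _) (v∈S , _) → v∉S v∈S)
    (λ (_ , _ , N⊆S) (v∉S , _) u~v → v∉S (N⊆S _ u~v))
    (λ Xu (_ , _ , ≁X) v~u → ≁X _ v~u Xu)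
    A.unique)

  M-count : tri χ B.new + length C.witnesses ≤ ∣ S ∣
  M-count = subst (λ m → m + length C.witnesses ≤ ∣ S ∣) B.size (count-with-Z B.witnesses B.⊆E
    (λ (_ , _ , _ , Xu , v~u) (_ , _ , ≁X) → ≁X _ v~u Xu)
    (λ (u∈S , _) (v∈S , _) → S≁S u∈S v∈S)
    (λ (u∈S , _) (v∈S , _) → S≁S v∈S u∈S)
    B.unique)

  total-bound : ∀ {ω} → (∀ Q → Clique G Q → ∣ Q ∣ ≤ ω) → 2 * total ≤ 2 * χ + ∣ S ∣ + ω + 6
  total-bound clique-bound = colour-count χ (tri₁-bound A.new) (tri₂-bound 2≤χ B.new) X-count M-count
    (clique-length G clique-bound C.clique-uniq C.clique-adj) C.count

-- At most one colour, and the conclusion.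

-- Covers the case outside the reach of `tri₂-bound`. With at most one colour there are no edges, so
-- the dynamic condition is vacuous.
edgeless-dynColourable : ∀ {n χ} (G : Graph n) → χ ≤ 1 → Colourable G χ → DynColourable G χ
edgeless-dynColourable G χ≤1 (c , c-proper) = c , c-proper ,
  λ v 2≤d → let u , _ , v~u , _ = 2≤degree⇒branching G 2≤d
            in contradiction (toℕ-injective (trans (is-0 v) (≡-sym (is-0 u)))) (c-proper v u v~u)
  where
  is-0 : ∀ v → toℕ (c v) ≡ 0
  is-0 v = ℕ.n<1⇒n≡0 (ℕ.<-≤-trans (toℕ<n (c v)) χ≤1)

theorem6 : ∀ {n : ℕ} (G : Graph n) (χ χ₂ α ω : ℕ) →
    IsChromaticNumber G χ → IsDynamicChromaticNumber G χ₂ →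
    IsIndependenceNumber G α → IsCliqueNumber G ω →
    2 * χ₂ ≤ 2 * χ + α + ω + 6
theorem6 G χ χ₂ α ω (col@(c , c-proper) , _) (_ , least) ((S , indep , refl) , maximum) (_ , clique-bound)
  with 2 ℕ.≤? χ
... | no 2≰χ = begin
  2 * χ₂             ≤⟨ ℕ.*-monoʳ-≤ 2 (least χ (edgeless-dynColourable G (s≤s⁻¹ (ℕ.≰⇒> 2≰χ)) col)) ⟩
  2 * χ              ≤⟨ ℕ.m≤m+n (2 * χ) α ⟩
  2 * χ + α          ≤⟨ ℕ.m≤m+n (2 * χ + α) ω ⟩
  2 * χ + α + ω      ≤⟨ ℕ.m≤m+n (2 * χ + α + ω) 6 ⟩
  2 * χ + α + ω + 6  ∎
  where open ℕ.≤-Reasoning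
... | yes 2≤χ = ℕ.≤-trans (ℕ.*-monoʳ-≤ 2 (least total dynColourable)) (total-bound clique-bound)
  where open Construction G 2≤χ c c-proper indep maximum
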